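{- Let $(C,e,\lambda,\oplus)$ be a Catalan structure, with secondary composition $\ominus$ and map $h\colon C\to C$ as defined in the context. Then $h(u\ominus v)=h(v)\oplus h(u)$ for all $u,v\in C$.
   Context: A Catalan structure is a quadruple $(C,e,\lambda,\oplus)$ where $C=\bigsqcup_{n\ge 0}C_n$ with $C_0=\{e\}$ ($|t|=n$ for $t\in C_n$), $\lambda\colon C_n\to C_{n+1}$, $\oplus\colon C_m\times C_n\to C_{m+n}$, $\oplus$ is associative with two-sided identity $e$, and every $t\in C$ can be written uniquely in exactly one of three forms: $t=e$; $t=\lambda(s)$ with $s\in C$ (indecomposable); $t=u\oplus v$ with $u$ indecomposable and $v\in C\setminus C_0$ (decomposable). Hence every nonempty $t$ is uniquely $\lambda(u)\oplus v$ ($v=e$ allowed). Put $\gamma(t)=t\oplus\lambda(e)$ and define $\ominus$ by $e\ominus v=v$, $\lambda(u)\ominus v=\lambda(u\ominus v)$, $(t\oplus u)\ominus v=t\oplus(u\ominus v)$ for $t,u\ne e$ (well defined; one may take $t$ indecomposable). The map $h$ is defined by $h(e)=e$, $h(\lambda(t))=\gamma(h(t))$, $h(u\oplus v)=h(v)\ominus h(u)$; equivalently $h(e)=e$ and $h(\lambda(u)\oplus v)=h(v)\ominus\gamma(h(u))$. -}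

module Defs where

open import Algebra.Structures using (IsMonoid)
open import Data.Empty using (⊥-elim)
open import Data.Nat using (ℕ; zero; suc; _+_; _<_; s≤s)
open import Data.Nat.Induction using (<-wellFounded)
open import Data.Nat.Properties using (≤-refl; m≤m+n; m≤n+m)
open import Data.Product using (Σ; ∃; ∃₂; _×_; _,_; proj₁; proj₂)
open import Data.Sum using (_⊎_; inj₁; inj₂)
open import Induction.WellFounded using (Acc; acc)
open import Level using (Level) renaming (suc to lsuc)
open import Relation.Binary.PropositionalEquality
  using (_≡_; _≢_; refl; sym; trans; cong; cong₂; subst; module ≡-Reasoning)
open import Relation.Nullary using (¬_)

record CatalanStructure (c : Level) : Set (lsuc c) where
  infixr 6 _⊕_ _⊕ₙ_
  field
    Cₙ   : ℕ → Set c
    e₀   : Cₙ 0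
    ƛₙ   : ∀ {n} → Cₙ n → Cₙ (suc n)
    _⊕ₙ_ : ∀ {m n} → Cₙ m → Cₙ n → Cₙ (m + n)

  -- The disjoint union of the Cₙ; all equations below are between its
  -- elements, so no transport along equalities of degrees is needed.
  C : Set c
  C = Σ ℕ Cₙ

  ∣_∣ : C → ℕ
  ∣_∣ = proj₁

  e : C
  e = 0 , e₀

  ƛ : C → C
  ƛ (n , s) = suc n , ƛₙ s

  _⊕_ : C → C → C
  (m , u) ⊕ (n , v) = m + n , u ⊕ₙ v

  Indecomposable : C → Set c
  Indecomposable t = ∃ λ s → t ≡ ƛ s

  Decomposable : C → Set c
  Decomposable t = ∃₂ λ u v → Indecomposable u × ∣ v ∣ ≢ 0 × t ≡ u ⊕ v

  field
    C₀-singleton : (t : Cₙ 0) → t ≡ e₀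
    ⊕-isMonoid   : IsMonoid _≡_ _⊕_ e

    -- Every element has one of the three forms, ...
    form : ∀ t → t ≡ e ⊎ Indecomposable t ⊎ Decomposable t
    -- ... no element has two of them, ...
    e-not-indecomposable            : ¬ Indecomposable e
    e-not-decomposable              : ¬ Decomposable e
    indecomposable-not-decomposable : ∀ {t} → Indecomposable t → ¬ Decomposable t
    -- ... and the presentation in each form is unique.
    ƛ-injective : ∀ {s s′} → ƛ s ≡ ƛ s′ → s ≡ s′
    ⊕-unique    : ∀ {u v u′ v′} →
                  Indecomposable u → ∣ v ∣ ≢ 0 →
                  Indecomposable u′ → ∣ v′ ∣ ≢ 0 →
                  u ⊕ v ≡ u′ ⊕ v′ → u ≡ u′ × v ≡ v′

module Catalan {c} (𝒞 : CatalanStructure c) where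
  open CatalanStructure 𝒞 public

  private
    module M = IsMonoid ⊕-isMonoid

    variable
      s t u v w : C

  -- A derivation that t is built from e by the two nonempty forms. Recursive
  -- definitions on C go by recursion on it; `fold-unique` says that the result
  -- depends on t only.
  data Generated : C → Set c where
    empty : Generated e
    indec : Generated s → Generated (ƛ s)
    decom : Generated s → ∣ v ∣ ≢ 0 → Generated v → Generated (ƛ s ⊕ v)

  private
    generated-acc : ∀ t → Acc _<_ ∣ t ∣ → Generated t
    generated-acc t (acc rs) with form t
    ... | inj₁ refl = empty
    ... | inj₂ (inj₁ (s , refl)) = indec (generated-acc s (rs ≤-refl))
    ... | inj₂ (inj₂ (_ , v , (s , refl) , v≢0 , refl)) =
      decom (generated-acc s (rs (s≤s (m≤m+n ∣ s ∣ ∣ v ∣)))) v≢0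
            (generated-acc v (rs (s≤s (m≤n+m ∣ v ∣ ∣ s ∣))))

  generated : ∀ t → Generated t
  generated t = generated-acc t (<-wellFounded ∣ t ∣)

  module Recursion {a} {A : Set a} (E : A) (L : C → A → A) (D : C → C → A → A → A) where

    fold : Generated t → A
    fold empty = E
    fold (indec {s} g) = L s (fold g)
    fold (decom {s} {v} g _ k) = D s v (fold g) (fold k)

    fold-unique : (g : Generated t) (g′ : Generated u) → t ≡ u → fold g ≡ fold g′
    fold-unique empty empty _ = refl
    fold-unique empty (indec {s} g) p = ⊥-elim (e-not-indecomposable (s , p))
    fold-unique empty (decom {s} {v} _ n _) p =
      ⊥-elim (e-not-decomposable (ƛ s , v , (s , refl) , n , p))
    fold-unique (indec {s} g) empty p = ⊥-elim (e-not-indecomposable (s , sym p))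
    fold-unique (indec g) (indec g′) p = cong₂ L (ƛ-injective p) (fold-unique g g′ (ƛ-injective p))
    fold-unique (indec {s} _) (decom {s′} {v} _ n _) p =
      ⊥-elim (indecomposable-not-decomposable (s , refl) (ƛ s′ , v , (s′ , refl) , n , p))
    fold-unique (decom {s} {v} _ n _) empty p =
      ⊥-elim (e-not-decomposable (ƛ s , v , (s , refl) , n , sym p))
    fold-unique (decom {s} {v} _ n _) (indec {s′} _) p =
      ⊥-elim (indecomposable-not-decomposable (s′ , refl) (ƛ s , v , (s , refl) , n , sym p))
    fold-unique (decom {s} {v} g n k) (decom {s′} {v′} g′ n′ k′) p
      with ⊕-unique (s , refl) n (s′ , refl) n′ p
    ... | ƛs≡ƛs′ , v≡v′
      with fold-unique g g′ (ƛ-injective ƛs≡ƛs′) | fold-unique k k′ v≡v′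
    ... | q | r = trans (cong₂ (λ x y → D x y (fold g) (fold k)) (ƛ-injective ƛs≡ƛs′) v≡v′)
                        (cong₂ (D s′ v′) q r)

    rec : C → A
    rec t = fold (generated t)

    rec-e : rec e ≡ E
    rec-e = fold-unique (generated e) empty refl

    rec-ƛ : ∀ s → rec (ƛ s) ≡ L s (rec s)
    rec-ƛ s = fold-unique (generated (ƛ s)) (indec (generated s)) refl

    rec-⊕ : ∀ s v → ∣ v ∣ ≢ 0 → rec (ƛ s ⊕ v) ≡ D s v (rec s) (rec v)
    rec-⊕ s v n = fold-unique (generated (ƛ s ⊕ v)) (decom (generated s) n (generated v)) refl

  γ : C → C
  γ t = t ⊕ ƛ e

  infixr 6 _⊖_

  private
    module Sec (w : C) =
      Recursion w (λ _ s⊖w → ƛ s⊖w) (λ s _ _ v⊖w → ƛ s ⊕ v⊖w)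

  -- e ⊖ w = w,  ƛ s ⊖ w = ƛ (s ⊖ w),  (ƛ s ⊕ v) ⊖ w = ƛ s ⊕ (v ⊖ w) for v ≠ e.
  _⊖_ : C → C → C
  t ⊖ w = Sec.rec w t

  private
    module H = Recursion e (λ _ hs → γ hs) (λ _ _ hs hv → hv ⊖ γ hs)

  -- h e = e,  h (ƛ s) = γ (h s),  h (ƛ s ⊕ v) = h v ⊖ h (ƛ s) for v ≠ e.
  h : C → C
  h = H.rec

  ∣v∣≡0⇒v≡e : ∀ v → ∣ v ∣ ≡ 0 → v ≡ e
  ∣v∣≡0⇒v≡e (zero , v) refl = cong (0 ,_) (C₀-singleton v)

  private
    ≢e⇒∣∣≢0 : v ≢ e → ∣ v ∣ ≢ 0
    ≢e⇒∣∣≢0 {v} v≢e p = v≢e (∣v∣≡0⇒v≡e v p)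

    +-≢0 : ∀ m {n} → n ≢ 0 → m + n ≢ 0
    +-≢0 zero    n≢0 = n≢0
    +-≢0 (suc m) n≢0 ()

  ⊖-e : ∀ w → e ⊖ w ≡ w
  ⊖-e w = Sec.rec-e w

  ⊖-ƛ : ∀ s w → ƛ s ⊖ w ≡ ƛ (s ⊖ w)
  ⊖-ƛ s w = Sec.rec-ƛ w s

  -- The defining equation for an arbitrary, not only an indecomposable, t ≠ e.
  ⊖-⊕ : ∀ t u w → t ≢ e → u ≢ e → (t ⊕ u) ⊖ w ≡ t ⊕ (u ⊖ w)
  ⊖-⊕ t u w t≢e u≢e = go (generated t) t≢e
    where
    open ≡-Reasoning
    n : ∣ u ∣ ≢ 0
    n = ≢e⇒∣∣≢0 u≢e
    go : ∀ {t} → Generated t → t ≢ e → (t ⊕ u) ⊖ w ≡ t ⊕ (u ⊖ w)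
    go empty q = ⊥-elim (q refl)
    go (indec {s} _) _ = Sec.rec-⊕ w s u n
    go (decom {s} {v} _ v≢0 k) _ = begin
      ((ƛ s ⊕ v) ⊕ u) ⊖ w  ≡⟨ cong (_⊖ w) (M.assoc (ƛ s) v u) ⟩
      (ƛ s ⊕ (v ⊕ u)) ⊖ w  ≡⟨ Sec.rec-⊕ w s (v ⊕ u) (+-≢0 ∣ v ∣ n) ⟩
      ƛ s ⊕ ((v ⊕ u) ⊖ w)  ≡⟨ cong (ƛ s ⊕_) (go k (λ p → v≢0 (cong proj₁ p))) ⟩
      ƛ s ⊕ (v ⊕ (u ⊖ w))  ≡⟨ M.assoc (ƛ s) v (u ⊖ w) ⟨
      (ƛ s ⊕ v) ⊕ (u ⊖ w)  ∎

  h-e : h e ≡ e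
  h-e = H.rec-e

  h-ƛ : ∀ t → h (ƛ t) ≡ γ (h t)
  h-ƛ = H.rec-ƛ

  h-⊕ : ∀ u v → Indecomposable u → v ≢ e → h (u ⊕ v) ≡ h v ⊖ h u
  h-⊕ _ v (s , refl) v≢e =
    trans (H.rec-⊕ s v (≢e⇒∣∣≢0 v≢e)) (cong (h v ⊖_) (sym (h-ƛ s)))

{-# OPTIONS --safe #-}
module Submission where

open import Algebra.Structures using (IsMonoid)
open import Data.Empty using (⊥-elim)
open import Data.Nat.Properties using (m+n≡0⇒n≡0)
open import Data.Product using (_,_; proj₁)
open import Defs
open import Level using (Level)
open import Relation.Binary.PropositionalEquality
  using (_≡_; _≢_; refl; sym; trans; cong; subst; module ≡-Reasoning)

-- Induction on how `u` is built, with `v` fixed. For `ƛ s`, both `ƛ` and `⊖` act at the left end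
-- while `γ` appends at the right, so associativity of `⊕` carries `h v` past `γ`. For `ƛ s ⊕ w`,
-- `h` turns the outer sum into `h (w ⊖ v) ⊖ h (ƛ s)`, the induction hypothesis rewrites the left
-- operand as `h v ⊕ h w`, and `⊕-⊖-assoc` pulls `h v` out. That last move requires `h w ≢ e`, which
-- is `h≢e`.

module Reversal {c} (𝒞 : CatalanStructure c) where
  open Catalan 𝒞
  open IsMonoid ⊕-isMonoid using (assoc; identityˡ; identityʳ)
  open ≡-Reasoning

  ∣∣≢0⇒≢e : ∀ {t} → ∣ t ∣ ≢ 0 → t ≢ e
  ∣∣≢0⇒≢e n p = n (cong proj₁ p)

  ƛ≢e : ∀ s → ƛ s ≢ e
  ƛ≢e s p with () ← cong proj₁ p

  ƛ⊕≢e : ∀ s v → ƛ s ⊕ v ≢ e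
  ƛ⊕≢e s v p with () ← cong proj₁ p

  γ≢e : ∀ t → γ t ≢ e
  γ≢e t p with () ← m+n≡0⇒n≡0 ∣ t ∣ (cong proj₁ p)

  -- The leading `ƛ` of `t` stays in front of the result, so its degree is positive.
  ⊖≢e : ∀ t w → t ≢ e → t ⊖ w ≢ e
  ⊖≢e t w = go (generated t)
    where
    go : ∀ {t} → Generated t → t ≢ e → t ⊖ w ≢ e
    go empty e≢e = ⊥-elim (e≢e refl)
    go (indec {s} _) _ = subst (_≢ e) (sym (⊖-ƛ s w)) (ƛ≢e (s ⊖ w))
    go (decom {s} {v} _ v≢0 _) _ =
      subst (_≢ e) (sym (⊖-⊕ (ƛ s) v w (ƛ≢e s) (∣∣≢0⇒≢e v≢0))) (ƛ⊕≢e s (v ⊖ w))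

  h-⊕-ƛ : ∀ s v → v ≢ e → h (ƛ s ⊕ v) ≡ h v ⊖ h (ƛ s)
  h-⊕-ƛ s v = h-⊕ (ƛ s) v (s , refl)

  -- A value of `h` at a nonempty element is either some `γ x` or a `⊖` whose left operand is `h` of
  -- a smaller nonempty element, so `⊖≢e` propagates the claim.
  h≢e : ∀ t → t ≢ e → h t ≢ e
  h≢e t = go (generated t)
    where
    go : ∀ {t} → Generated t → t ≢ e → h t ≢ e
    go empty e≢e = ⊥-elim (e≢e refl)
    go (indec {s} _) _ = subst (_≢ e) (sym (h-ƛ s)) (γ≢e (h s))
    go (decom {s} {v} _ v≢0 k) _ =
      subst (_≢ e) (sym (h-⊕-ƛ s v v≢e)) (⊖≢e (h v) (h (ƛ s)) (go k v≢e))
      where v≢e = ∣∣≢0⇒≢e v≢0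

  -- False for u = e, since ƛ s ⊖ w = ƛ (s ⊖ w) ≠ ƛ s ⊕ w for w ≠ e; hence the need for h≢e.
  ⊕-⊖-assoc : ∀ t u w → u ≢ e → (t ⊕ u) ⊖ w ≡ t ⊕ (u ⊖ w)
  ⊕-⊖-assoc t u w u≢e = go (generated t)
    where
    go : ∀ {t} → Generated t → (t ⊕ u) ⊖ w ≡ t ⊕ (u ⊖ w)
    -- The one case beyond `⊖-⊕`; it is needed because `h v` is `e` when `v` is.
    go empty = trans (cong (_⊖ w) (identityˡ u)) (sym (identityˡ (u ⊖ w)))
    go (indec {s} _) = ⊖-⊕ (ƛ s) u w (ƛ≢e s) u≢e
    go (decom {s} {v} _ _ _) = ⊖-⊕ (ƛ s ⊕ v) u w (ƛ⊕≢e s v) u≢e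

  h-⊖ : ∀ u v → h (u ⊖ v) ≡ h v ⊕ h u
  h-⊖ u v = go (generated u)
    where
    go : ∀ {u} → Generated u → h (u ⊖ v) ≡ h v ⊕ h u
    go empty = begin
      h (e ⊖ v)  ≡⟨ cong h (⊖-e v) ⟩
      h v        ≡⟨ identityʳ (h v) ⟨
      h v ⊕ e    ≡⟨ cong (h v ⊕_) h-e ⟨
      h v ⊕ h e  ∎
    go (indec {s} g) = begin
      h (ƛ s ⊖ v)      ≡⟨ cong h (⊖-ƛ s v) ⟩
      h (ƛ (s ⊖ v))    ≡⟨ h-ƛ (s ⊖ v) ⟩
      γ (h (s ⊖ v))    ≡⟨ cong γ (go g) ⟩
      γ (h v ⊕ h s)    ≡⟨ assoc (h v) (h s) (ƛ e) ⟩
      h v ⊕ γ (h s)    ≡⟨ cong (h v ⊕_) (h-ƛ s) ⟨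
      h v ⊕ h (ƛ s)    ∎
    go (decom {s} {w} _ w≢0 k) = begin
      h ((ƛ s ⊕ w) ⊖ v)        ≡⟨ cong h (⊖-⊕ (ƛ s) w v (ƛ≢e s) w≢e) ⟩
      -- The rule for `h` on a sum wants a nonempty second summand, and `w ⊖ v` is one for every
      -- `v`.
      h (ƛ s ⊕ (w ⊖ v))        ≡⟨ h-⊕-ƛ s (w ⊖ v) (⊖≢e w v w≢e) ⟩
      h (w ⊖ v) ⊖ h (ƛ s)      ≡⟨ cong (_⊖ h (ƛ s)) (go k) ⟩
      (h v ⊕ h w) ⊖ h (ƛ s)    ≡⟨ ⊕-⊖-assoc (h v) (h w) (h (ƛ s)) (h≢e w w≢e) ⟩
      h v ⊕ (h w ⊖ h (ƛ s))    ≡⟨ cong (h v ⊕_) (h-⊕-ƛ s w w≢e) ⟨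
      h v ⊕ h (ƛ s ⊕ w)        ∎
      where w≢e = ∣∣≢0⇒≢e w≢0

corollary2p10 : ∀ {c : Level} (𝒞 : CatalanStructure c) →
    let open Catalan 𝒞 in
    ∀ (u v : C) → h (u ⊖ v) ≡ h v ⊕ h u
corollary2p10 𝒞 = Reversal.h-⊖ 𝒞
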